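{- Every tournament on $n$ vertices can be embedded in an invertible (and hence unimodular) tournament on $2n$ vertices; that is, for every tournament $T$ on $n$ vertices there is an invertible tournament on $2n$ vertices having a subtournament isomorphic to $T$.
   Context: The skew-adjacency matrix of a tournament with vertex set $\{v_1,\ldots,v_n\}$ is the $n\times n$ zero-diagonal matrix $S=[s_{ij}]$ in which $s_{ij}=1$ and $s_{ji}=-1$ if $v_i$ dominates $v_j$. A tournament is unimodular if the determinant of its skew-adjacency matrix is $1$. A unimodular tournament with skew-adjacency matrix $S$ is invertible if $S^{ -1}$ is the skew-adjacency matrix of a tournament. A subtournament is the tournament induced on a subset of the vertices. -}

module Defs where

open import Algebra.Properties.Monoid.Sum using ()
open import Data.Bool.Base using (if_then_else_)
open import Data.Fin.Base using (Fin; zero; suc; toℕ; punchIn)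
open import Data.Fin.Properties using (_≟_)
open import Data.Fin.Subset using (Subset; _∈_)
open import Data.Integer.Base using (ℤ; 0ℤ; 1ℤ; -1ℤ; _*_; _^_)
open import Data.Integer.Properties using (+-0-monoid)
open import Data.Nat.Base using (ℕ; zero; suc)
open import Data.Product.Base using (Σ; ∃-syntax; _×_; _,_; proj₁)
open import Data.Vec.Properties.WithK using ([]=-irrelevant)
open import Function.Base using (_on_)
open import Function.Bundles using (_↔_; _⇔_; Inverse)
open import Level using (0ℓ)
open import Relation.Binary.Core using (Rel)
open import Relation.Binary.Definitions using (Trichotomous; tri<; tri≈; tri>)
open import Relation.Binary.PropositionalEquality.Core using (_≡_; refl; cong)
open import Relation.Nullary.Decidable.Core using (does)

open Algebra.Properties.Monoid.Sum +-0-monoid using (sum) public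

Matrix : ℕ → Set
Matrix n = Fin n → Fin n → ℤ

infix 4 _≈ᴹ_
_≈ᴹ_ : ∀ {n} → Matrix n → Matrix n → Set
A ≈ᴹ B = ∀ i j → A i j ≡ B i j

identity : ∀ {n} → Matrix n
identity i j = if does (i ≟ j) then 1ℤ else 0ℤ

infixl 7 _*ᴹ_
_*ᴹ_ : ∀ {n} → Matrix n → Matrix n → Matrix n
(A *ᴹ B) i k = sum λ j → A i j * B j k

-- Laplace expansion along the first row; the empty matrix has determinant 1.
det : ∀ {n} → Matrix n → ℤ
det {zero}  A = 1ℤ
det {suc n} A =
  sum λ j → -1ℤ ^ toℕ j * A zero j * det (λ i k → A (suc i) (punchIn j k))

IsInverseOf : ∀ {n} → Matrix n → Matrix n → Set
IsInverseOf B A = (A *ᴹ B ≈ᴹ identity) × (B *ᴹ A ≈ᴹ identity)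

-- u ⟶ v reads "u dominates v".  Trichotomy says that exactly one of
-- u ⟶ v, u ≡ v, v ⟶ u holds; no transitivity is required.
record Tournament (V : Set) : Set₁ where
  infix 4 _⟶_
  field
    _⟶_     : Rel V 0ℓ
    compare : Trichotomous _≡_ _⟶_

open Tournament

skewAdjacency : ∀ {n} → Tournament (Fin n) → Matrix n
skewAdjacency T i j with compare T i j
... | tri< _ _ _ = 1ℤ
... | tri≈ _ _ _ = 0ℤ
... | tri> _ _ _ = -1ℤ

Unimodular : ∀ {n} → Tournament (Fin n) → Set
Unimodular T = det (skewAdjacency T) ≡ 1ℤ

-- An inverse that is a skew-adjacency matrix has integer entries, so nothing
-- is lost by taking inverses over ℤ instead of over ℚ.
Invertible : ∀ {n} → Tournament (Fin n) → Set₁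
Invertible {n} T =
  Unimodular T ×
  (Σ (Tournament (Fin n)) λ U → IsInverseOf (skewAdjacency U) (skewAdjacency T))

Vertices : ∀ {n} → Subset n → Set
Vertices X = ∃[ v ] v ∈ X

vertex-≡ : ∀ {n} {X : Subset n} {u v : Vertices X} → proj₁ u ≡ proj₁ v → u ≡ v
vertex-≡ {u = u , p} {v = .u , q} refl = cong (u ,_) ([]=-irrelevant p q)

subtournament : ∀ {n} → Tournament (Fin n) → (X : Subset n) → Tournament (Vertices X)
subtournament T X ._⟶_ = _⟶_ T on proj₁
subtournament T X .compare u v with compare T (proj₁ u) (proj₁ v)
... | tri< a ¬b ¬c = tri< a (λ e → ¬b (cong proj₁ e)) ¬c
... | tri≈ ¬a b ¬c = tri≈ ¬a (vertex-≡ b) ¬c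
... | tri> ¬a ¬b c = tri> ¬a (λ e → ¬b (cong proj₁ e)) c

infix 4 _≅_
record _≅_ {V W : Set} (T : Tournament V) (U : Tournament W) : Set where
  field
    bijection : V ↔ W
  open Inverse bijection using (to)
  field
    dominates : ∀ u v → _⟶_ T u v ⇔ _⟶_ U (to u) (to v)

{-# OPTIONS --safe #-}

-- Replace every vertex i of T by an arc (i , 0) ⟶ (i , 1), both ends inheriting
-- the arcs of i.  If S is the matrix of T, the result has matrix
-- M = S ⊗ J + I ⊗ K, where J is the all-ones 2 × 2 matrix and K is the matrix
-- of a single arc.  With D = I ⊗ diag (1 , -1) one finds M D M = D, so that
-- M⁻¹ = D M D, which is M with some pairs of opposite signs exchanged.
-- The determinant is 1 because expanding along the two rows of a doubled
-- vertex leaves the doubling of T minus that vertex: the two columns of the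
-- vertex agree in all other rows, so the remaining minors vanish or cancel.
module Submission where

open import Defs
open import Data.Fin.Base
  using (Fin; zero; suc; toℕ; punchIn; remQuot; combine; quotient; remainder)
open import Data.Fin.Properties using (_≟_; remQuot-combine; combine-remQuot)
open import Data.Fin.Subset using (Subset; _∈_)
open import Data.Integer.Base
  using (ℤ; 0ℤ; 1ℤ; -1ℤ; _+_; _-_; _^_) renaming (_*_ to _·_)
import Data.Integer.Properties as ℤ
open import Algebra.Properties.Semiring.Sum ℤ.+-*-semiring
  using (sum-cong-≗; sum-replicate-zero; ∑-distrib-+; *-distribˡ-sum; *-distribʳ-sum)
open import Data.Integer.Tactic.RingSolver using (solve-∀)
open import Data.Nat.Base using (ℕ; zero; suc; _*_)
open import Data.Nat.Properties using (*-comm)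
open import Data.Product.Base using (Σ; ∃-syntax; _×_; _,_; proj₁; proj₂; uncurry)
open import Data.Sum.Base using (_⊎_; inj₁; inj₂)
open import Data.Vec.Base using (tabulate)
open import Data.Vec.Properties using (lookup∘tabulate; lookup⇒[]=; []=⇒lookup)
open import Function.Base using (_∘_)
open import Function.Bundles using (_↔_; mk↔ₛ′; mk⇔)
open import Relation.Binary.Definitions using (tri<; tri≈; tri>)
open import Relation.Binary.PropositionalEquality
  using (_≡_; _≢_; refl; sym; trans; cong; cong₂; subst; module ≡-Reasoning)
open import Relation.Nullary.Decidable.Core using (yes; no; does)
open import Relation.Nullary.Negation.Core using (contradiction)

open Tournament
open ≡-Reasoning

-- Sums and determinants

sum-zero : ∀ {n} {f : Fin n → ℤ} → (∀ i → f i ≡ 0ℤ) → sum f ≡ 0ℤ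
sum-zero {n} f≗0 = trans (sum-cong-≗ f≗0) (sum-replicate-zero n)

-- The indices `combine i zero` and `combine i (suc zero)` are consecutive, so two terms can be
-- peeled off at a time.
sum-pairs : ∀ n (f : Fin (n * 2) → ℤ) →
  sum f ≡ sum λ (i : Fin n) → f (combine i zero) + f (combine i (suc zero))
sum-pairs zero    f = refl
sum-pairs (suc n) f =
  trans (sym (ℤ.+-assoc (f zero) (f (suc zero)) _))
        (cong (f zero + f (suc zero) +_) (sum-pairs n λ x → f (suc (suc x))))

minor : ∀ {n} → Matrix (suc n) → Fin (suc n) → Matrix n
minor A j i k = A (suc i) (punchIn j k)

det-cong : ∀ {n} {A B : Matrix n} → A ≈ᴹ B → det A ≡ det B
det-cong {zero}  A≈B = refl
det-cong {suc n} A≈B = sum-cong-≗ λ j →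
  cong₂ _·_ (cong (-1ℤ ^ toℕ j ·_) (A≈B zero j))
            (det-cong λ i k → A≈B (suc i) (punchIn j k))

-- The minors at the first two columns coincide and enter with opposite signs. Every other minor
-- still contains both columns, now equal in all its rows, so it vanishes by the lemma itself.
det-equalColumnsBelow : ∀ {m} (A : Matrix (suc (suc m))) →
  (∀ i → A (suc i) zero ≡ A (suc i) (suc zero)) →
  det A ≡ (A zero zero - A zero (suc zero)) · det (minor A zero)
det-equalColumnsBelow {m} A eq = begin
  det A
    ≡⟨ cong (λ t → 1ℤ · a · d + (-1ℤ · b · det (minor A (suc zero)) + t))
            (sum-zero (tail A eq)) ⟩
  1ℤ · a · d + (-1ℤ · b · det (minor A (suc zero)) + 0ℤ)
    ≡⟨ cong (λ t → 1ℤ · a · d + (-1ℤ · b · t + 0ℤ)) (det-cong minors) ⟩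
  1ℤ · a · d + (-1ℤ · b · d + 0ℤ)
    ≡⟨ collect a b d ⟩
  (a - b) · d ∎
  where
  a = A zero zero
  b = A zero (suc zero)
  d = det (minor A zero)

  collect : ∀ a b d → 1ℤ · a · d + (-1ℤ · b · d + 0ℤ) ≡ (a - b) · d
  collect = solve-∀

  minors : minor A (suc zero) ≈ᴹ minor A zero
  minors i zero    = eq i
  minors i (suc k) = refl

  tail : ∀ {m} (A : Matrix (suc (suc m))) →
    (∀ i → A (suc i) zero ≡ A (suc i) (suc zero)) → (j : Fin m) →
    -1ℤ ^ toℕ (suc (suc j)) · A zero (suc (suc j)) · det (minor A (suc (suc j))) ≡ 0ℤ
  tail {suc m} A eq j = begin
    c · det B
      ≡⟨ cong (c ·_) (det-equalColumnsBelow B (λ i → eq (suc i))) ⟩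
    c · ((B zero zero - B zero (suc zero)) · det (minor B zero))
      -- The first row of `B` comes from the second row of `A`, where the two columns already agree.
      ≡⟨ cong (λ t → c · (t · det (minor B zero))) (ℤ.i≡j⇒i-j≡0 (eq zero)) ⟩
    c · (0ℤ · det (minor B zero))
      ≡⟨ ℤ.*-zeroʳ c ⟩
    0ℤ ∎
    where
    B = minor A (suc (suc j))
    c = -1ℤ ^ toℕ (suc (suc j)) · A zero (suc (suc j))

-- Expand along the first row. Column zero contributes nothing; column one, after a second
-- expansion, contributes `det C` minus `sum lower`; the other columns contribute `sum upper`, which
-- equals `sum lower` term by term.
det-twins : ∀ {m} (A : Matrix (suc (suc m))) →
  A zero zero ≡ 0ℤ → A zero (suc zero) ≡ 1ℤ →
  A (suc zero) zero ≡ -1ℤ → A (suc zero) (suc zero) ≡ 0ℤ →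
  (∀ j → A zero (suc (suc j)) ≡ A (suc zero) (suc (suc j))) →
  (∀ i → A (suc (suc i)) zero ≡ A (suc (suc i)) (suc zero)) →
  det A ≡ det (λ i j → A (suc (suc i)) (suc (suc j)))
det-twins {m} A a₀₀ a₀₁ a₁₀ a₁₁ rows cols = begin
  1ℤ · A zero zero · det (minor A zero)
    + (-1ℤ · A zero (suc zero) · det B + sum upper)
    ≡⟨ cong₂ (λ s t → 1ℤ · s · det (minor A zero) + (-1ℤ · t · det B + sum upper))
             a₀₀ a₀₁ ⟩
  0ℤ + (-1ℤ · (1ℤ · A (suc zero) zero · det C + sum lower) + sum upper)
    ≡⟨ cong₂ (λ s t → 0ℤ + (-1ℤ · (1ℤ · s · det C + sum lower) + t))
             a₁₀ (sum-cong-≗ (upper≗lower A a₁₀ a₁₁ rows cols)) ⟩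
  0ℤ + (-1ℤ · (-1ℤ · det C + sum lower) + sum lower)
    ≡⟨ cancel (det C) (sum lower) ⟩
  det C ∎
  where
  B = minor A (suc zero)
  C = minor B zero

  upper lower : Fin m → ℤ
  upper j = -1ℤ ^ toℕ (suc (suc j)) · A zero (suc (suc j)) · det (minor A (suc (suc j)))
  lower j = -1ℤ ^ toℕ (suc j) · B zero (suc j) · det (minor B (suc j))

  cancel : ∀ c l → 0ℤ + (-1ℤ · (-1ℤ · c + l) + l) ≡ c
  cancel = solve-∀

  -- The first two columns of `E` agree below its first row, so `det E` is `-1ℤ` times one minor,
  -- and this sign absorbs the extra `-1ℤ` on the left. That minor keeps column one of `A` where the
  -- right-hand one keeps column zero; below the twin rows these are equal.
  upper≗lower : ∀ {m} (A : Matrix (suc (suc m))) →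
    A (suc zero) zero ≡ -1ℤ → A (suc zero) (suc zero) ≡ 0ℤ →
    (∀ j → A zero (suc (suc j)) ≡ A (suc zero) (suc (suc j))) →
    (∀ i → A (suc (suc i)) zero ≡ A (suc (suc i)) (suc zero)) → (j : Fin m) →
    -1ℤ ^ toℕ (suc (suc j)) · A zero (suc (suc j)) · det (minor A (suc (suc j))) ≡
    -1ℤ ^ toℕ (suc j) · A (suc zero) (suc (suc j)) · det (minor (minor A (suc zero)) (suc j))
  upper≗lower {suc m} A a₁₀ a₁₁ rows cols j = begin
    -1ℤ · p · A zero (suc (suc j)) · det E
      ≡⟨ cong₂ (λ s t → -1ℤ · p · s · t) (rows j) (det-equalColumnsBelow E cols) ⟩
    -1ℤ · p · r · ((A (suc zero) zero - A (suc zero) (suc zero)) · det (minor E zero))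
      ≡⟨ cong₂ (λ s t → -1ℤ · p · r · ((s - t) · det (minor E zero))) a₁₀ a₁₁ ⟩
    -1ℤ · p · r · (-1ℤ · det (minor E zero))
      ≡⟨ signs p r _ ⟩
    p · r · det (minor E zero)
      ≡⟨ cong (p · r ·_) (det-cong minors) ⟩
    p · r · det (minor (minor A (suc zero)) (suc j)) ∎
    where
    E = minor A (suc (suc j))
    p = -1ℤ ^ toℕ (suc j)
    r = A (suc zero) (suc (suc j))

    signs : ∀ p r e → -1ℤ · p · r · (-1ℤ · e) ≡ p · r · e
    signs = solve-∀

    minors : minor E zero ≈ᴹ minor (minor A (suc zero)) (suc j)
    minors i zero    = sym (cols i)
    minors i (suc k) = refl

-- The identity matrix

identity-diagonal : ∀ {n} (i : Fin n) → identity i i ≡ 1ℤ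
identity-diagonal zero    = refl
identity-diagonal (suc i) = identity-diagonal i

identity-offDiagonal : ∀ {n} {i j : Fin n} → i ≢ j → identity i j ≡ 0ℤ
identity-offDiagonal {i = i} {j} i≢j with i ≟ j
... | yes i≡j = contradiction i≡j i≢j
... | no  _   = refl

identity-sym : ∀ {n} (i j : Fin n) → identity i j ≡ identity j i
identity-sym zero    zero    = refl
identity-sym zero    (suc j) = refl
identity-sym (suc i) zero    = refl
identity-sym (suc i) (suc j) = identity-sym i j

sum-identityˡ : ∀ {n} (i : Fin n) (f : Fin n → ℤ) → sum (λ j → identity i j · f j) ≡ f i
sum-identityˡ {suc n} zero    f =
  trans (cong₂ _+_ (ℤ.*-identityˡ (f zero)) (sum-zero {n = n} λ j → refl)) (ℤ.+-identityʳ (f zero))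
sum-identityˡ (suc i) f = trans (ℤ.+-identityˡ _) (sum-identityˡ i (f ∘ suc))

sum-identityʳ : ∀ {n} (f : Fin n → ℤ) (k : Fin n) → sum (λ j → f j · identity j k) ≡ f k
sum-identityʳ f k = trans
  (sum-cong-≗ λ j → trans (ℤ.*-comm (f j) _) (cong (_· f j) (identity-sym j k)))
  (sum-identityˡ k f)

-- Kronecker factorisation of the identity: moving on by two indices raises the quotient by one and
-- keeps the remainder.
identity-remQuot : ∀ n (x z : Fin (n * 2)) →
  identity x z ≡ identity (quotient {n} 2 x) (quotient {n} 2 z)
               · identity (remainder {n} 2 x) (remainder {n} 2 z)
identity-remQuot (suc n) zero          zero          = refl
identity-remQuot (suc n) zero          (suc zero)    = refl
identity-remQuot (suc n) zero          (suc (suc z)) = refl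
identity-remQuot (suc n) (suc zero)    zero          = refl
identity-remQuot (suc n) (suc zero)    (suc zero)    = refl
identity-remQuot (suc n) (suc zero)    (suc (suc z)) = refl
identity-remQuot (suc n) (suc (suc x)) zero          = refl
identity-remQuot (suc n) (suc (suc x)) (suc zero)    = refl
identity-remQuot (suc n) (suc (suc x)) (suc (suc z)) = identity-remQuot n x z

remQuot-injective : ∀ {n} {x y : Fin (n * 2)} → remQuot {n} 2 x ≡ remQuot {n} 2 y → x ≡ y
remQuot-injective {n} {x} {y} eq =
  trans (sym (combine-remQuot {n} 2 x))
        (trans (cong (uncurry combine) eq) (combine-remQuot {n} 2 y))

-- Tournaments and their matrices

-- Trichotomy read off a matrix. Both entries of a pair are recorded, so that skew-symmetry is
-- included; `V` is arbitrary so that pairs can serve as indices.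
data Arc {V : Set} (A : V → V → ℤ) (u v : V) : Set where
  forward  : A u v ≡ 1ℤ → A v u ≡ -1ℤ → Arc A u v
  diagonal : u ≡ v → A u v ≡ 0ℤ → Arc A u v
  backward : A u v ≡ -1ℤ → A v u ≡ 1ℤ → Arc A u v

1≢-1 : ∀ {x} → x ≡ 1ℤ → x ≢ -1ℤ
1≢-1 refl ()

1≢0 : ∀ {x} → x ≡ 1ℤ → x ≢ 0ℤ
1≢0 refl ()

fromMatrix : ∀ {n} (A : Matrix n) → (∀ i j → Arc A i j) → Tournament (Fin n)
fromMatrix A arc ._⟶_ i j = A i j ≡ 1ℤ
fromMatrix A arc .compare i j with arc i j
... | forward p q    = tri< p (λ { refl → 1≢-1 p q }) (λ r → 1≢-1 r q)
... | diagonal refl p = tri≈ (λ r → 1≢0 r p) refl (λ r → 1≢0 r p)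
... | backward p q   = tri> (λ r → 1≢-1 r p) (λ { refl → 1≢-1 q p }) q

skewAdjacency-fromMatrix : ∀ {n} (A : Matrix n) (arc : ∀ i j → Arc A i j) →
  skewAdjacency (fromMatrix A arc) ≈ᴹ A
skewAdjacency-fromMatrix A arc i j with arc i j
... | forward p q     = sym p
... | diagonal refl p = sym p
... | backward p q    = sym p

module _ {n} (T : Tournament (Fin n)) where

  ⟶⇒1 : ∀ {i j} → _⟶_ T i j → skewAdjacency T i j ≡ 1ℤ
  ⟶⇒1 {i} {j} i⟶j with compare T i j
  ... | tri< _ _ _ = refl
  ... | tri≈ ¬i⟶j _ _ = contradiction i⟶j ¬i⟶j
  ... | tri> ¬i⟶j _ _ = contradiction i⟶j ¬i⟶j

  ⟵⇒-1 : ∀ {i j} → _⟶_ T j i → skewAdjacency T i j ≡ -1ℤ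
  ⟵⇒-1 {i} {j} j⟶i with compare T i j
  ... | tri< _ _ ¬j⟶i = contradiction j⟶i ¬j⟶i
  ... | tri≈ _ _ ¬j⟶i = contradiction j⟶i ¬j⟶i
  ... | tri> _ _ _ = refl

  skewAdjacency-diagonal : ∀ i → skewAdjacency T i i ≡ 0ℤ
  skewAdjacency-diagonal i with compare T i i
  ... | tri< _ i≢i _ = contradiction refl i≢i
  ... | tri≈ _ _ _ = refl
  ... | tri> _ i≢i _ = contradiction refl i≢i

  1⇒⟶ : ∀ {i j} → skewAdjacency T i j ≡ 1ℤ → _⟶_ T i j
  1⇒⟶ {i} {j} p with compare T i j
  ... | tri< i⟶j _ _ = i⟶j

  skewAdjacency-arc : ∀ i j → Arc (skewAdjacency T) i j
  skewAdjacency-arc i j with compare T i j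
  ... | tri< i⟶j _ _ = forward (⟶⇒1 i⟶j) (⟵⇒-1 i⟶j)
  ... | tri≈ _ refl _ = diagonal refl (skewAdjacency-diagonal i)
  ... | tri> _ _ j⟶i = backward (⟵⇒-1 j⟶i) (⟶⇒1 j⟶i)

-- Doubling

K : Matrix 2
K zero       zero       = 0ℤ
K zero       (suc zero) = 1ℤ
K (suc zero) zero       = -1ℤ
K (suc zero) (suc zero) = 0ℤ

sign : Fin 2 → ℤ
sign zero       = 1ℤ
sign (suc zero) = -1ℤ

-- The entries of `S ⊗ J + I ⊗ K`; those of `J` are all one and leave no factor.
pairDouble : ∀ {n} → Matrix n → Fin n × Fin 2 → Fin n × Fin 2 → ℤ
pairDouble S (i , a) (j , b) = S i j + identity i j · K a b

double : ∀ {n} → Matrix n → Matrix (n * 2)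
double {n} S x y = pairDouble S (remQuot {n} 2 x) (remQuot {n} 2 y)

-- The diagonal of `D`.
ε : ∀ n → Fin (n * 2) → ℤ
ε n x = sign (remainder {n} 2 x)

-- The matrix `D M D`.
conjugate : ∀ {n} → Matrix n → Matrix (n * 2)
conjugate {n} S x y = ε n x · ε n y · double S x y

det-double : ∀ {n} (S : Matrix n) → (∀ i → S i i ≡ 0ℤ) → det (double S) ≡ 1ℤ
det-double {zero}  S S₀ = refl
det-double {suc n} S S₀ = trans
  (det-twins (double S) (cong (_+ 0ℤ) (S₀ zero)) (cong (_+ 1ℤ) (S₀ zero))
     -- Outside the leading block `identity` contributes `0ℤ` to the twin rows and columns, so they
     -- agree by computation.
     (cong (_+ -1ℤ) (S₀ zero)) (cong (_+ 0ℤ) (S₀ zero)) (λ j → refl) (λ i → refl))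
  (det-double (λ i j → S (suc i) (suc j)) (S₀ ∘ suc))

-- The inverse of the doubled matrix

sign-square : ∀ a → sign a · sign a ≡ 1ℤ
sign-square zero       = refl
sign-square (suc zero) = refl

-- With `E = diag (1 , -1)`, this is the 2 × 2 product `(s J + d K) E (s′ J + d′ K)`, expanded by
-- `J E J = 0`, `J E K = J`, `K E J = - J` and `K E K = E`.
block-sum : ∀ a b s s′ d d′ →
  (s + d · K a zero) · (1ℤ · (s′ + d′ · K zero b))
    + (s + d · K a (suc zero)) · (-1ℤ · (s′ + d′ · K (suc zero) b))
  ≡ s · d′ + (-1ℤ · (d · s′) + d · d′ · (sign a · identity a b))
block-sum zero       zero       = solve-∀
block-sum zero       (suc zero) = solve-∀
block-sum (suc zero) zero       = solve-∀
block-sum (suc zero) (suc zero) = solve-∀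

-- This is `M D M = D`. Summed over the middle vertex, the two mixed terms of `block-sum` give
-- `S i k` and its negative, leaving only the diagonal term.
double-ε-double : ∀ {n} (S : Matrix n) x z →
  sum (λ y → double S x y · (ε n y · double S y z)) ≡ ε n x · identity x z
double-ε-double {n} S x z = begin
  sum f
    ≡⟨ sum-pairs n f ⟩
  sum (λ j → f (combine {n} {2} j zero) + f (combine {n} {2} j (suc zero)))
    ≡⟨ sum-cong-≗ (λ j → cong₂ _+_ (entry j zero) (entry j (suc zero))) ⟩
  sum (λ j → g j zero + g j (suc zero))
    ≡⟨ sum-cong-≗ (λ j → block-sum a b (S i j) (S j k) (identity i j) (identity j k)) ⟩
  sum (λ j → S i j · identity j k + (-1ℤ · (identity i j · S j k) + identity i j · identity j k · c))
    ≡⟨ trans (∑-distrib-+ (λ j → S i j · identity j k)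
                          (λ j → -1ℤ · (identity i j · S j k) + identity i j · identity j k · c))
             (cong₂ _+_ (sum-identityʳ (S i) k)
                        (∑-distrib-+ (λ j → -1ℤ · (identity i j · S j k))
                                     (λ j → identity i j · identity j k · c))) ⟩
  S i k + (sum (λ j → -1ℤ · (identity i j · S j k)) + sum (λ j → identity i j · identity j k · c))
    ≡⟨ cong₂ (λ s t → S i k + (s + t))
         (trans (sym (*-distribˡ-sum -1ℤ (λ j → identity i j · S j k)))
                (cong (-1ℤ ·_) (sum-identityˡ i (λ j → S j k))))
         (trans (sym (*-distribʳ-sum c (λ j → identity i j · identity j k)))
                (cong (_· c) (sum-identityˡ i (λ j → identity j k)))) ⟩
  S i k + (-1ℤ · S i k + identity i k · (sign a · identity a b))
    ≡⟨ rearrange (S i k) (identity i k) (sign a) (identity a b) ⟩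
  sign a · (identity i k · identity a b)
    ≡⟨ cong (sign a ·_) (identity-remQuot n x z) ⟨
  sign a · identity x z ∎
  where
  i = quotient {n} 2 x
  a = remainder {n} 2 x
  k = quotient {n} 2 z
  b = remainder {n} 2 z
  c = sign a · identity a b

  f : Fin (n * 2) → ℤ
  f y = double S x y · (ε n y · double S y z)

  g : Fin n → Fin 2 → ℤ
  g j e = pairDouble S (i , a) (j , e) · (sign e · pairDouble S (j , e) (k , b))

  entry : ∀ j e → f (combine {n} {2} j e) ≡ g j e
  entry j e = cong
    (λ q → pairDouble S (i , a) q · (sign (proj₂ q) · pairDouble S q (k , b)))
    (remQuot-combine {n} {2} j e)

  rearrange : ∀ s d e t → s + (-1ℤ · s + d · (e · t)) ≡ e · (d · t)
  rearrange = solve-∀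

-- `M (D M D) = (M D M) D = D D = I`.
double-*-conjugate : ∀ {n} (S : Matrix n) → double S *ᴹ conjugate S ≈ᴹ identity
double-*-conjugate {n} S x z = begin
  sum (λ y → double S x y · (ε n y · ε n z · double S y z))
    ≡⟨ sum-cong-≗ (λ y → factor (double S x y) (ε n y) (ε n z) (double S y z)) ⟩
  sum (λ y → ε n z · (double S x y · (ε n y · double S y z)))
    ≡⟨ *-distribˡ-sum (ε n z) (λ y → double S x y · (ε n y · double S y z)) ⟨
  ε n z · sum (λ y → double S x y · (ε n y · double S y z))
    ≡⟨ cong (ε n z ·_) (double-ε-double S x z) ⟩
  ε n z · (ε n x · identity x z)
    ≡⟨ signs ⟩
  identity x z ∎
  where
  factor : ∀ p e e′ q → p · (e · e′ · q) ≡ e′ · (p · (e · q))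
  factor = solve-∀

  -- The two signs belong to different indices and form a square only where `identity x z` is
  -- nonzero.
  signs : ε n z · (ε n x · identity x z) ≡ identity x z
  signs with x ≟ z
  ... | yes refl = trans (cong (ε n x ·_) (ℤ.*-identityʳ (ε n x))) (sign-square (remainder {n} 2 x))
  ... | no  _    = trans (cong (ε n z ·_) (ℤ.*-zeroʳ (ε n x))) (ℤ.*-zeroʳ (ε n z))

-- `(D M D) M = D (M D M) = D D = I`.
conjugate-*-double : ∀ {n} (S : Matrix n) → conjugate S *ᴹ double S ≈ᴹ identity
conjugate-*-double {n} S x z = begin
  sum (λ y → ε n x · ε n y · double S x y · double S y z)
    ≡⟨ sum-cong-≗ (λ y → factor (double S x y) (ε n y) (ε n x) (double S y z)) ⟩
  sum (λ y → ε n x · (double S x y · (ε n y · double S y z)))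
    ≡⟨ *-distribˡ-sum (ε n x) (λ y → double S x y · (ε n y · double S y z)) ⟨
  ε n x · sum (λ y → double S x y · (ε n y · double S y z))
    ≡⟨ cong (ε n x ·_) (double-ε-double S x z) ⟩
  ε n x · (ε n x · identity x z)
    ≡⟨ ℤ.*-assoc (ε n x) (ε n x) (identity x z) ⟨
  ε n x · ε n x · identity x z
    ≡⟨ cong (_· identity x z) (sign-square (remainder {n} 2 x)) ⟩
  1ℤ · identity x z
    ≡⟨ ℤ.*-identityˡ (identity x z) ⟩
  identity x z ∎
  where
  factor : ∀ p e e′ q → e′ · e · p · q ≡ e′ · (p · (e · q))
  factor = solve-∀

-- Both matrices come from tournaments

K-arc : ∀ a b → Arc K a b
K-arc zero       zero       = diagonal refl refl
K-arc zero       (suc zero) = forward refl refl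
K-arc (suc zero) zero       = backward refl refl
K-arc (suc zero) (suc zero) = diagonal refl refl

module _ {n} (S : Matrix n) where

  between : ∀ {i j a b} → i ≢ j → pairDouble S (i , a) (j , b) ≡ S i j
  between {i} {j} {a} {b} i≢j =
    trans (cong (λ d → S i j + d · K a b) (identity-offDiagonal i≢j)) (ℤ.+-identityʳ (S i j))

  within : ∀ {i a b} → S i i ≡ 0ℤ → pairDouble S (i , a) (i , b) ≡ K a b
  within {i} {a} {b} S₀ =
    trans (cong₂ (λ s d → s + d · K a b) S₀ (identity-diagonal i))
          (trans (ℤ.+-identityˡ _) (ℤ.*-identityˡ (K a b)))

  pairDouble-arc : (∀ i j → Arc S i j) → ∀ u v → Arc (pairDouble S) u v
  pairDouble-arc arc (i , a) (j , b) with arc i j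
  ... | forward p q = forward
          -- If `i` and `j` were equal, one entry would be both `1ℤ` and `-1ℤ`.
          (trans (between λ { refl → 1≢-1 p q }) p)
          (trans (between λ { refl → 1≢-1 p q }) q)
  ... | backward p q = backward
          (trans (between λ { refl → 1≢-1 q p }) p)
          (trans (between λ { refl → 1≢-1 q p }) q)
  -- Two copies of one vertex are compared by `K` alone.
  ... | diagonal refl S₀ with K-arc a b
  ...   | forward p q     = forward (trans (within S₀) p) (trans (within S₀) q)
  ...   | backward p q    = backward (trans (within S₀) p) (trans (within S₀) q)
  ...   | diagonal refl p = diagonal refl (trans (within S₀) p)

  double-arc : (∀ i j → Arc S i j) → ∀ x y → Arc (double S) x y
  double-arc arc x y with pairDouble-arc arc (remQuot {n} 2 x) (remQuot {n} 2 y)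
  ... | forward p q  = forward p q
  ... | diagonal e p = diagonal (remQuot-injective e) p
  ... | backward p q = backward p q

sign-product : ∀ a b → (sign a · sign b ≡ 1ℤ × sign b · sign a ≡ 1ℤ)
                     ⊎ (sign a · sign b ≡ -1ℤ × sign b · sign a ≡ -1ℤ)
sign-product zero       zero       = inj₁ (refl , refl)
sign-product zero       (suc zero) = inj₂ (refl , refl)
sign-product (suc zero) zero       = inj₂ (refl , refl)
sign-product (suc zero) (suc zero) = inj₁ (refl , refl)

-- The factor `ε n x · ε n y` is symmetric in `x` and `y`: it keeps an arc when it is `1ℤ` and
-- reverses it when it is `-1ℤ`.
conjugate-arc : ∀ {n} (S : Matrix n) → (∀ i j → Arc S i j) → ∀ x y → Arc (conjugate S) x y
conjugate-arc {n} S arc x y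
  with double-arc S arc x y | sign-product (remainder {n} 2 x) (remainder {n} 2 y)
... | diagonal e p | _ = diagonal e
        (trans (cong (ε n x · ε n y ·_) p) (ℤ.*-zeroʳ (ε n x · ε n y)))
... | forward p q  | inj₁ (e , e′) = forward (cong₂ _·_ e p) (cong₂ _·_ e′ q)
... | forward p q  | inj₂ (e , e′) = backward (cong₂ _·_ e p) (cong₂ _·_ e′ q)
... | backward p q | inj₁ (e , e′) = backward (cong₂ _·_ e p) (cong₂ _·_ e′ q)
... | backward p q | inj₂ (e , e′) = forward (cong₂ _·_ e p) (cong₂ _·_ e′ q)

-- Invertibility of the doubled tournament

*ᴹ-cong : ∀ {n} {A A′ B B′ : Matrix n} → A ≈ᴹ A′ → B ≈ᴹ B′ → A *ᴹ B ≈ᴹ A′ *ᴹ B′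
*ᴹ-cong A≈A′ B≈B′ i k = sum-cong-≗ λ j → cong₂ _·_ (A≈A′ i j) (B≈B′ j k)

module _ {n} (T : Tournament (Fin n)) where

  private
    S = skewAdjacency T
    arc = skewAdjacency-arc T

  doubleTournament : Tournament (Fin (n * 2))
  doubleTournament = fromMatrix (double S) (double-arc S arc)

  doubleTournament-invertible : Invertible doubleTournament
  doubleTournament-invertible =
    trans (det-cong M≈) (det-double S (skewAdjacency-diagonal T)) ,
    fromMatrix (conjugate S) (conjugate-arc S arc) ,
    (λ x z → trans (*ᴹ-cong M≈ N≈ x z) (double-*-conjugate S x z)) ,
    (λ x z → trans (*ᴹ-cong N≈ M≈ x z) (conjugate-*-double S x z))
    where
    M≈ = skewAdjacency-fromMatrix (double S) (double-arc S arc)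
    N≈ = skewAdjacency-fromMatrix (conjugate S) (conjugate-arc S arc)

  -- The copy of the given tournament

  tails : Subset (n * 2)
  tails = tabulate λ x → does (remainder {n} 2 x ≟ zero)

  tail∈tails : ∀ i → combine {n} {2} i zero ∈ tails
  tail∈tails i = lookup⇒[]= (combine {n} {2} i zero) tails
    (trans (lookup∘tabulate _ (combine {n} {2} i zero))
           (cong (λ q → does (proj₂ q ≟ zero)) (remQuot-combine {n} {2} i zero)))

  remainder-tail : ∀ {x} → x ∈ tails → remainder {n} 2 x ≡ zero
  remainder-tail {x} x∈ with remainder {n} 2 x ≟ zero
    | trans (sym (lookup∘tabulate (λ x → does (remainder {n} 2 x ≟ zero)) x)) ([]=⇒lookup x∈)
  -- In the `no` case membership in `tails` would equate the two Booleans.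
  ... | yes r≡0 | _ = r≡0

  remQuot-tail : ∀ {x} → x ∈ tails → remQuot {n} 2 x ≡ (quotient {n} 2 x , zero)
  remQuot-tail {x} x∈ = cong (quotient {n} 2 x ,_) (remainder-tail x∈)

  tails↔ : Vertices tails ↔ Fin n
  tails↔ = mk↔ₛ′
    (λ (x , _) → quotient {n} 2 x)
    (λ i → combine {n} {2} i zero , tail∈tails i)
    (λ i → cong proj₁ (remQuot-combine {k = 2} i zero))
    (λ (x , x∈) → vertex-≡
      (trans (cong (uncurry combine) (sym (remQuot-tail x∈))) (combine-remQuot {n} 2 x)))

  subtournament-tails : subtournament doubleTournament tails ≅ T
  subtournament-tails = record
    { bijection = tails↔
    ; dominates = λ u v → mk⇔ (λ p → 1⇒⟶ T (trans (sym (entry u v)) p))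
                              (λ i⟶j → trans (entry u v) (⟶⇒1 T i⟶j))
    }
    where
    -- Both remainders are zero and `K zero zero` is `0ℤ`, so the correction to `S` disappears even
    -- when the two vertices coincide.
    entry : ∀ (u v : Vertices tails) →
      double S (proj₁ u) (proj₁ v) ≡ S (quotient {n} 2 (proj₁ u)) (quotient {n} 2 (proj₁ v))
    entry (x , x∈) (y , y∈) =
      trans (cong₂ (pairDouble S) (remQuot-tail x∈) (remQuot-tail y∈))
            (trans (cong (S i j +_) (ℤ.*-zeroʳ (identity i j))) (ℤ.+-identityʳ (S i j)))
      where
      i = quotient {n} 2 x
      j = quotient {n} 2 y

mainTheorem3 : (n : ℕ) (T : Tournament (Fin n)) →
    Σ (Tournament (Fin (2 * n))) λ U →
    Invertible U × (∃[ X ] subtournament U X ≅ T)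
mainTheorem3 n T = subst
  (λ m → Σ (Tournament (Fin m)) λ U → Invertible U × (∃[ X ] subtournament U X ≅ T))
  -- Pairs are indexed by `Fin (n * 2)`, where `remQuot` and `combine` peel off two indices per
  -- vertex; only the final result is transported.
  (*-comm n 2)
  (doubleTournament T , doubleTournament-invertible T , tails T , subtournament-tails T)
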